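{- The digraph $\vec{C}_3\Rightarrow K_1$ is not a hero in orientations of chordal graphs; that is, for every integer $k$ there exists an orientation of a chordal graph containing no induced copy of $\vec{C}_3\Rightarrow K_1$ and having dichromatic number greater than $k$.
   Context: All digraphs are finite and simple (no loops, no parallel arcs, no digons). An orientation of a chordal graph is a digraph whose underlying undirected graph has no induced cycle of length at least $4$. The dichromatic number of a digraph is the least $k$ such that its vertex set can be partitioned into $k$ sets each inducing an acyclic subdigraph. A digraph $H$ is a hero in a hereditary class $\mathcal{C}$ if the digraphs in $\mathcal{C}$ with no induced copy of $H$ have bounded dichromatic number. $\vec{C}_3\Rightarrow K_1$ is the digraph consisting of a directed triangle together with a fourth vertex that is an out-neighbour of all three triangle vertices. -}

module Defs where

open import Data.Nat using (ℕ; zero; suc; _≤_)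
open import Data.Fin using (Fin; toℕ; zero; suc)
open import Data.Product using (Σ; _×_; _,_)
open import Data.Sum using (_⊎_)
open import Data.Empty using (⊥)
open import Data.Unit using (⊤)
open import Relation.Nullary using (¬_)
open import Relation.Binary.PropositionalEquality using (_≡_)
open import Function using (_⇔_)
open import Function.Definitions using (Injective)

record Digraph : Set₁ where
  field
    n        : ℕ
    Arc      : Fin n → Fin n → Set
    noLoop   : ∀ u → ¬ Arc u u
    noDigon  : ∀ u v → Arc u v → ¬ Arc v u
open Digraph public

CycSucc : (m : ℕ) → Fin m → Fin m → Set
CycSucc m i j = (suc (toℕ i) ≡ toℕ j) ⊎ ((suc (toℕ i) ≡ m) × (toℕ j ≡ 0))

CycAdj : (m : ℕ) → Fin m → Fin m → Set
CycAdj m i j = CycSucc m i j ⊎ CycSucc m j i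

Adj : (D : Digraph) → Fin (n D) → Fin (n D) → Set
Adj D u v = Arc D u v ⊎ Arc D v u

InducedCycle : (D : Digraph) → Set
InducedCycle D =
  Σ ℕ λ m → (4 ≤ m) × (Σ (Fin m → Fin (n D)) λ c →
     Injective _≡_ _≡_ c × (∀ i j → Adj D (c i) (c j) ⇔ CycAdj m i j))

IsChordalOrientation : Digraph → Set
IsChordalOrientation D = ¬ InducedCycle D

DirCycleIn : (D : Digraph) → (Fin (n D) → Set) → Set
DirCycleIn D S =
  Σ ℕ λ m → (2 ≤ m) × (Σ (Fin m → Fin (n D)) λ w →
     Injective _≡_ _≡_ w × (∀ i → S (w i)) ×
     (∀ i j → CycSucc m i j → Arc D (w i) (w j)))

Acyclic : (D : Digraph) → (Fin (n D) → Set) → Set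
Acyclic D S = ¬ DirCycleIn D S

-- D admits a partition into k sets each inducing an acyclic subdigraph
-- (a k-dicolouring; colour classes may be empty)
Dicolourable : Digraph → ℕ → Set
Dicolourable D k =
  Σ (Fin (n D) → Fin k) λ col → ∀ a → Acyclic D (λ v → col v ≡ a)

DichromaticGreaterThan : Digraph → ℕ → Set
DichromaticGreaterThan D k = ¬ Dicolourable D k

InducedCopy : Digraph → Digraph → Set
InducedCopy H D =
  Σ (Fin (n H) → Fin (n D)) λ f →
    Injective _≡_ _≡_ f × (∀ u v → Arc D (f u) (f v) ⇔ Arc H u v)

C3⇒K1-arc : Fin 4 → Fin 4 → Set
C3⇒K1-arc zero (suc zero) = ⊤
C3⇒K1-arc (suc zero) (suc (suc zero)) = ⊤
C3⇒K1-arc (suc (suc zero)) zero = ⊤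
C3⇒K1-arc zero (suc (suc (suc zero))) = ⊤
C3⇒K1-arc (suc zero) (suc (suc (suc zero))) = ⊤
C3⇒K1-arc (suc (suc zero)) (suc (suc (suc zero))) = ⊤
C3⇒K1-arc _ _ = ⊥

private
  c-noLoop : ∀ u → ¬ C3⇒K1-arc u u
  c-noLoop zero ()
  c-noLoop (suc zero) ()
  c-noLoop (suc (suc zero)) ()
  c-noLoop (suc (suc (suc zero))) ()

  c-noDigon : ∀ u v → C3⇒K1-arc u v → ¬ C3⇒K1-arc v u
  c-noDigon zero (suc zero) _ ()
  c-noDigon (suc zero) (suc (suc zero)) _ ()
  c-noDigon (suc (suc zero)) zero _ ()
  c-noDigon zero (suc (suc (suc zero))) _ ()
  c-noDigon (suc zero) (suc (suc (suc zero))) _ ()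
  c-noDigon (suc (suc zero)) (suc (suc (suc zero))) _ ()

C3⇒K1 : Digraph
C3⇒K1 = record { n = 4 ; Arc = C3⇒K1-arc ; noLoop = c-noLoop ; noDigon = c-noDigon }

{-# OPTIONS --safe #-}
-- A copy of C₃ ⇒ K₁ has no source, so letting a transitive clique dominate a
-- new part creates no such copy.  Let G₀ be empty, and
-- obtain Gⱼ₊₁ from Gⱼ as follows: for every transitive clique A of size j add
-- a copy of Gⱼ dominated by A, and for every transitive clique B of size j in
-- that copy add an apex c with B ⇒ c ⇒ A.  In a colouring without
-- monochromatic directed triangle, Gⱼ has a rainbow transitive clique of size
-- j: take rainbow A in Gⱼ and rainbow B in its copy.  If some b ∈ B has a
-- colour that is missing in A, then A ∪ {b} is rainbow.  Otherwise c avoids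
-- every colour of B, as it would close a monochromatic triangle a → b → c → a,
-- so B ∪ {c} is rainbow.  Hence Gₖ₊₁ is not k-dicolourable.
module Submission where

open import Defs
open import Data.Nat using (ℕ; zero; suc; _+_; _*_; _^_; _≤_; _<_; z≤n; s≤s)
open import Data.Nat.Properties using (≤-refl; ≤-trans; ≤-total; <⇒≱; <-≤-trans; +-monoʳ-<; +-cancelˡ-≤; m≤m+n; n<1+n; suc-injective; 1+n≢n; 0≢1+n; m≢1+n+m; <⇒≤; +-monoʳ-≤)
open import Data.Fin using (Fin; zero; suc; toℕ; fromℕ; inject₁)
open import Data.Fin.Properties using (_≟_; pigeonhole; +↔⊎; *↔×; 0↔⊥; 1↔⊤; toℕ-fromℕ; toℕ-inject₁; <⇒≢)
open import Data.Fin.Relation.Unary.Top using (view; ‵fromℕ; ‵inject₁)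
open import Data.Product using (Σ; ∃; _×_; _,_)
open import Data.Product.Function.NonDependent.Propositional using (_×-cong_)
open import Data.Sum as Sum using (_⊎_; inj₁; inj₂)
open import Data.Sum.Function.Propositional using (_⊎-cong_)
open import Data.Empty using (⊥; ⊥-elim)
open import Data.Unit using (tt)
open import Data.Vec using (Vec; []; _∷_; map; lookup)
open import Data.Vec.Properties using (map-∘)
open import Data.Vec.Membership.Propositional using (_∈_; lose)
open import Data.Vec.Membership.Propositional.Properties using (∈-lookup; fromAny)
open import Data.Vec.Relation.Unary.All as All using (All; []; _∷_)
open import Data.Vec.Relation.Unary.All.Properties as All using ()
open import Data.Vec.Relation.Unary.AllPairs as AllPairs using (AllPairs; []; _∷_)
open import Data.Vec.Relation.Unary.AllPairs.Properties as AllPairs using ()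
open import Data.Vec.Relation.Unary.Any using (any?; here; there)
open import Data.Vec.Relation.Unary.Unique.Propositional using (Unique)
open import Data.Vec.Relation.Unary.Unique.Propositional.Properties using (lookup-injective)
open import Function using (_∘_; _↔_; mk↔ₛ′; Inverse; Equivalence)
open import Function.Properties.Inverse using (↔-sym; ↔-trans)
open import Relation.Nullary using (¬_; yes; no; contradiction)
open import Relation.Binary.PropositionalEquality using (_≡_; _≢_; refl; sym; trans; cong; subst)

-- Vectors, enumerations and maxima.

all-∈ : {A : Set} {P : A → Set} {n : ℕ} (xs : Vec A n) → (∀ {x} → x ∈ xs → P x) → All P xs
all-∈ xs p = All.lookup⁻ (λ i → p (∈-lookup i xs))

-- The missing-colour alternative has the `All` form that `Unique` asks for when a rainbow vector
-- gets a new head.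
inColours : {V : Set} {k n : ℕ} (col : V → Fin k) (A : Vec V n) (c : Fin k) →
  (∃ λ a → a ∈ A × c ≡ col a) ⊎ All (c ≢_) (map col A)
inColours col A c with any? (λ a → c ≟ col a) A
... | yes c∈ = inj₁ (fromAny c∈)
... | no c∉ = inj₂ (All.map⁺ (all-∈ A (λ a∈A c≡a → c∉ (lose a∈A c≡a))))

Vec↔Fin : {A : Set} {n : ℕ} → A ↔ Fin n → (j : ℕ) → Vec A j ↔ Fin (n ^ j)
Vec↔Fin e zero = ↔-trans (mk↔ₛ′ (λ _ → tt) (λ _ → []) (λ _ → refl) (λ { [] → refl })) (↔-sym 1↔⊤)
Vec↔Fin e (suc j) = ↔-trans
  (mk↔ₛ′ (λ { (x ∷ xs) → x , xs }) (λ { (x , xs) → x ∷ xs }) (λ { (_ , _) → refl }) (λ { (_ ∷ _) → refl }))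
  (↔-trans (e ×-cong Vec↔Fin e j) (↔-sym *↔×))

argmax : {m : ℕ} (f : Fin (suc m) → ℕ) → ∃ λ i → ∀ j → f j ≤ f i
argmax {zero} f = zero , λ { zero → ≤-refl }
argmax {suc m} f with argmax (f ∘ suc)
... | i , max with ≤-total (f zero) (f (suc i))
... | inj₁ f0≤fi = suc i , λ { zero → f0≤fi ; (suc j) → max j }
... | inj₂ fi≤f0 = zero , λ { zero → ≤-refl ; (suc j) → ≤-trans (max j) fi≤f0 }

-- Transitive cliques, dominated triangles and simplicial ranks.

module _ {V : Set} (_⟶_ : V → V → Set) where

  SymClosure : V → V → Set
  SymClosure u v = u ⟶ v ⊎ v ⟶ u

  -- Later entries point to earlier ones, so the head is the sink, and a vertex dominated by the
  -- clique is added by consing.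
  TransitiveClique : {j : ℕ} → Vec V j → Set
  TransitiveClique = AllPairs (λ x y → y ⟶ x)

  -- In a loopless asymmetric digraph these six arcs already force four distinct vertices and no
  -- further arcs, so this is exactly the absence of an induced `C3⇒K1`.
  NoDominatedTriangle : Set
  NoDominatedTriangle = ∀ {x y z w} → x ⟶ y → y ⟶ z → z ⟶ x → x ⟶ w → y ⟶ w → z ⟶ w → ⊥

  -- A perfect elimination ordering in which ties are allowed.
  SimplicialRank : (V → ℕ) → Set
  SimplicialRank rank = ∀ {u v w} → SymClosure u v → SymClosure w v → u ≢ w →
    rank u ≤ rank v → rank w ≤ rank v → SymClosure u w

  NoMonochromaticTriangle : {C : Set} → (V → C) → Set
  NoMonochromaticTriangle col = ∀ {x y z} → x ⟶ y → y ⟶ z → z ⟶ x →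
    col x ≡ col y → col y ≡ col z → ⊥

  clique-connected : {j : ℕ} {A : Vec V j} → TransitiveClique A →
    ∀ {x y} → x ∈ A → y ∈ A → x ≢ y → SymClosure x y
  clique-connected (_ ∷ _) (here refl) (here refl) x≢y = contradiction refl x≢y
  clique-connected (A→x ∷ _) (here refl) (there y∈A) x≢y = inj₂ (All.lookup A→x y∈A)
  clique-connected (A→y ∷ _) (there x∈A) (here refl) x≢y = inj₁ (All.lookup A→y x∈A)
  clique-connected (_ ∷ K) (there x∈A) (there y∈A) x≢y = clique-connected K x∈A y∈A x≢y

  module _ (loopless : ∀ {u} → ¬ u ⟶ u) (asym : ∀ {u v} → u ⟶ v → ¬ v ⟶ u) where

    head-is-sink : {j : ℕ} {x y : V} {A : Vec V j} →
      All (_⟶ x) A → y ∈ x ∷ A → ¬ x ⟶ y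
    head-is-sink _ (here refl) x→x = loopless x→x
    head-is-sink A→x (there y∈A) x→y = asym x→y (All.lookup A→x y∈A)

    -- The head is a sink of the clique, so a directed triangle cannot pass through it and would lie
    -- in the tail.
    clique-triangle-free : {j : ℕ} {A : Vec V j} → TransitiveClique A →
      ∀ {x y z} → x ∈ A → y ∈ A → z ∈ A → x ⟶ y → y ⟶ z → z ⟶ x → ⊥
    clique-triangle-free (s ∷ K) (here refl) y∈A z∈A xy yz zx = head-is-sink s y∈A xy
    clique-triangle-free (s ∷ K) x∈A (here refl) z∈A xy yz zx = head-is-sink s z∈A yz
    clique-triangle-free (s ∷ K) x∈A y∈A (here refl) xy yz zx = head-is-sink s x∈A zx
    clique-triangle-free (s ∷ K) (there x∈A) (there y∈A) (there z∈A) xy yz zx =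
      clique-triangle-free K x∈A y∈A z∈A xy yz zx

-- Finite digraphs on arbitrary vertex types.

-- Carrying an enumeration lets each stage use an inductive vertex type; `toDigraph` returns to
-- numbered vertices.
record FiniteDigraph : Set₁ where
  field
    V            : Set
    size         : ℕ
    enumeration  : V ↔ Fin size
    _⟶_          : V → V → Set
    loopless     : ∀ {u} → ¬ u ⟶ u
    asym         : ∀ {u v} → u ⟶ v → ¬ v ⟶ u

  open Inverse enumeration public using ()
    renaming (to to encode; from to decode; strictlyInverseˡ to encode-decode; strictlyInverseʳ to decode-encode)

  encode-injective : ∀ {u v} → encode u ≡ encode v → u ≡ v
  encode-injective {u} {v} eq = trans (sym (decode-encode u)) (trans (cong decode eq) (decode-encode v))

  decode-injective : ∀ {i j} → decode i ≡ decode j → i ≡ j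
  decode-injective {i} {j} eq = trans (sym (encode-decode i)) (trans (cong encode eq) (encode-decode j))

toDigraph : FiniteDigraph → Digraph
toDigraph G = record
  { n       = size
  ; Arc     = λ i j → decode i ⟶ decode j
  ; noLoop  = λ _ → loopless
  ; noDigon = λ _ _ → asym
  }
  where open FiniteDigraph G

-- Chordality from a simplicial rank.

-- The witnesses are the cyclic predecessor and successor of `i`; length at least 4 keeps them
-- distinct and non-adjacent.
cycle-neighbours : {m : ℕ} → 4 ≤ m → (i : Fin m) → ∃ λ p → ∃ λ q →
  p ≢ q × CycAdj m p i × CycAdj m q i × ¬ CycAdj m p q
cycle-neighbours {suc (suc (suc (suc m)))} (s≤s (s≤s (s≤s (s≤s _)))) zero =
  suc zero , fromℕ (suc (suc (suc m))) , (λ ())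
  , inj₂ (inj₁ refl)
  , inj₁ (inj₂ (cong (4 +_) (toℕ-fromℕ m) , refl))
  , λ { (inj₁ (inj₁ ())) ; (inj₁ (inj₂ (() , _))) ; (inj₂ (inj₁ ())) ; (inj₂ (inj₂ (_ , ()))) }
-- Position 1 is separate because its predecessor is 0: wrapping around from `q` to `p` is excluded
-- here by the length, but in the `‵inject₁` case by `p` being nonzero.
cycle-neighbours {suc (suc (suc (suc m)))} (s≤s (s≤s (s≤s (s≤s _)))) (suc zero) =
  zero , suc (suc zero) , (λ ())
  , inj₁ (inj₁ refl)
  , inj₂ (inj₁ refl)
  , λ { (inj₁ (inj₁ ())) ; (inj₁ (inj₂ (() , _))) ; (inj₂ (inj₁ ())) ; (inj₂ (inj₂ (() , _))) }
cycle-neighbours {suc (suc (suc (suc m)))} (s≤s (s≤s (s≤s (s≤s _)))) (suc (suc i)) with view i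
... | ‵fromℕ {n = suc m} =
  p , zero , (λ ())
  , inj₁ (inj₁ (cong suc toℕ-p))
  , inj₂ (inj₂ (cong (3 +_) (toℕ-fromℕ (suc m)) , refl))
  , λ { (inj₁ (inj₁ ()))
      ; (inj₁ (inj₂ (eq , _))) →
          1+n≢n (sym (trans (sym (trans (cong suc toℕ-p) (cong (2 +_) (toℕ-fromℕ (suc m))))) eq))
      ; (inj₂ (inj₁ eq)) → 0≢1+n (suc-injective (trans eq toℕ-p))
      ; (inj₂ (inj₂ (() , _))) }
  where
  p : Fin (suc (suc (suc (suc m))))
  p = inject₁ (suc (fromℕ (suc m)))
  toℕ-p : toℕ p ≡ suc (toℕ (fromℕ (suc m)))
  toℕ-p = toℕ-inject₁ (suc (fromℕ (suc m)))
... | ‵inject₁ i′ =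
  p , q , (λ p≡q → p≢q (trans (sym toℕ-p) (cong toℕ p≡q)))
  , inj₁ (inj₁ (cong suc (trans toℕ-p (cong suc (sym (toℕ-inject₁ i′))))))
  , inj₂ (inj₁ (cong (3 +_) (toℕ-inject₁ i′)))
  , λ { (inj₁ (inj₁ eq)) → 1+n≢n (sym (trans (sym (cong suc toℕ-p)) eq))
      ; (inj₁ (inj₂ (_ , ())))
      ; (inj₂ (inj₁ eq)) → m≢1+n+m _ {2} (sym (trans eq toℕ-p))
      ; (inj₂ (inj₂ (_ , ()))) }
  where
  p q : Fin (suc (suc (suc (suc m))))
  p = inject₁ (suc (inject₁ i′))
  q = suc (suc (suc i′))
  toℕ-p : toℕ p ≡ suc (toℕ i′)
  toℕ-p = trans (toℕ-inject₁ (suc (inject₁ i′))) (cong suc (toℕ-inject₁ i′))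
  p≢q : suc (toℕ i′) ≢ toℕ q
  p≢q = m≢1+n+m _ {1}

-- On the cycle, both neighbours of a vertex of maximal rank lie no higher than it, so simpliciality
-- yields a chord.
simplicialRank⇒chordal : (G : FiniteDigraph) (let open FiniteDigraph G) (rank : V → ℕ) →
  SimplicialRank _⟶_ rank → IsChordalOrientation (toDigraph G)
simplicialRank⇒chordal G rank simplicial (suc m , 4≤m , c , c-injective , c-induced)
  with argmax (rank ∘ FiniteDigraph.decode G ∘ c)
... | i , max with cycle-neighbours 4≤m i
... | p , q , p≢q , p~i , q~i , p≁q = p≁q (Equivalence.to (c-induced p q)
  (simplicial (Equivalence.from (c-induced p i) p~i) (Equivalence.from (c-induced q i) q~i)
    (p≢q ∘ c-injective ∘ FiniteDigraph.decode-injective G) (max p) (max q)))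

-- Induced copies and dicolourings in terms of triangles.

noDominatedTriangle⇒C3⇒K1-free : (G : FiniteDigraph) → NoDominatedTriangle (FiniteDigraph._⟶_ G) →
  ¬ InducedCopy C3⇒K1 (toDigraph G)
noDominatedTriangle⇒C3⇒K1-free G free (f , _ , induced) =
  free (arc x y tt) (arc y z tt) (arc z x tt) (arc x w tt) (arc y w tt) (arc z w tt)
  where
  x y z w : Fin 4
  x = zero
  y = suc zero
  z = suc (suc zero)
  w = suc (suc (suc zero))
  arc : ∀ u v → C3⇒K1-arc u v → Arc (toDigraph G) (f u) (f v)
  arc u v = Equivalence.from (induced u v)

triangle⇒dirCycle : (D : Digraph) {S : Fin (n D) → Set} {x y z : Fin (n D)} →
  S x → S y → S z → Arc D x y → Arc D y z → Arc D z x → DirCycleIn D S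
triangle⇒dirCycle D {S} {x} {y} {z} Sx Sy Sz xy yz zx =
  3 , s≤s (s≤s z≤n) , w , w-injective _ _ , w-∈S , w-arc
  where
  w : Fin 3 → Fin (n D)
  w = lookup (x ∷ y ∷ z ∷ [])
  distinct : ∀ {u v} → Arc D u v → u ≢ v
  distinct uv refl = noLoop D _ uv
  w-injective : ∀ i j → w i ≡ w j → i ≡ j
  w-injective zero zero _ = refl
  w-injective zero (suc zero) eq = ⊥-elim (distinct xy eq)
  w-injective zero (suc (suc zero)) eq = ⊥-elim (distinct zx (sym eq))
  w-injective (suc zero) zero eq = ⊥-elim (distinct xy (sym eq))
  w-injective (suc zero) (suc zero) _ = refl
  w-injective (suc zero) (suc (suc zero)) eq = ⊥-elim (distinct yz eq)
  w-injective (suc (suc zero)) zero eq = ⊥-elim (distinct zx eq)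
  w-injective (suc (suc zero)) (suc zero) eq = ⊥-elim (distinct yz (sym eq))
  w-injective (suc (suc zero)) (suc (suc zero)) _ = refl
  w-∈S : ∀ i → S (w i)
  w-∈S zero = Sx
  w-∈S (suc zero) = Sy
  w-∈S (suc (suc zero)) = Sz
  w-arc : ∀ i j → CycSucc 3 i j → Arc D (w i) (w j)
  w-arc zero (suc zero) _ = xy
  w-arc (suc zero) (suc (suc zero)) _ = yz
  w-arc (suc (suc zero)) zero _ = zx
  w-arc zero zero (inj₁ ())
  w-arc zero zero (inj₂ (() , _))
  w-arc zero (suc (suc zero)) (inj₁ ())
  w-arc zero (suc (suc zero)) (inj₂ (() , _))
  w-arc (suc zero) zero (inj₁ ())
  w-arc (suc zero) zero (inj₂ (() , _))
  w-arc (suc zero) (suc zero) (inj₁ ())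
  w-arc (suc zero) (suc zero) (inj₂ (() , _))
  w-arc (suc (suc zero)) (suc zero) (inj₁ ())
  w-arc (suc (suc zero)) (suc zero) (inj₂ (_ , ()))
  w-arc (suc (suc zero)) (suc (suc zero)) (inj₁ ())
  w-arc (suc (suc zero)) (suc (suc zero)) (inj₂ (_ , ()))

dicolouring⇒noMonochromaticTriangle : (G : FiniteDigraph) (let open FiniteDigraph G) {k : ℕ} →
  Dicolourable (toDigraph G) k → Σ (V → Fin k) (NoMonochromaticTriangle _⟶_)
dicolouring⇒noMonochromaticTriangle G (col , acyclic) = col ∘ encode , λ xy yz zx x≡y y≡z →
  acyclic _ (triangle⇒dirCycle (toDigraph G) {λ v → col v ≡ _} refl (sym x≡y) (sym (trans x≡y y≡z))
    (lift xy) (lift yz) (lift zx))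
  where
  open FiniteDigraph G
  lift : ∀ {u v} → u ⟶ v → decode (encode u) ⟶ decode (encode v)
  lift {u} {v} uv rewrite decode-encode u | decode-encode v = uv

-- The invariant of the induction.

-- `bound` is kept so that the next stage can rank its copies and apices above all old vertices.
record ChordalDigraph : Set₁ where
  field
    digraph : FiniteDigraph
  open FiniteDigraph digraph public
  field
    noDominatedTriangle : NoDominatedTriangle _⟶_
    rank                : V → ℕ
    bound               : ℕ
    rank<bound          : ∀ v → rank v < bound
    simplicial          : SimplicialRank _⟶_ rank

ForcesRainbow : ℕ → ℕ → ChordalDigraph → Set
ForcesRainbow k j G = let open ChordalDigraph G in
  (col : V → Fin k) → NoMonochromaticTriangle _⟶_ col →
  Σ (Vec V j) λ A → TransitiveClique _⟶_ A × Unique (map col A)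

-- One extension step.

module Extension (j : ℕ) (G : ChordalDigraph) where
  open ChordalDigraph G

  Clique : Set
  Clique = Vec V j

  -- Copies and apices also exist for vectors that are not transitive cliques;
  -- these are not attached to anything, so cliquehood need not be decided.
  data V⁺ : Set where
    old  : V → V⁺
    copy : Clique → V → V⁺
    apex : Clique → Clique → V⁺

  -- Arcs between layers only run cyclically, old to copy to apex to old. Hence a directed triangle
  -- stays among the old vertices, stays in one copy, or visits all three layers.
  data _⟶⁺_ : V⁺ → V⁺ → Set where
    old→old   : ∀ {u v} → u ⟶ v → old u ⟶⁺ old v
    copy→copy : ∀ {A x y} → x ⟶ y → copy A x ⟶⁺ copy A y
    old→copy  : ∀ {A u x} → TransitiveClique _⟶_ A → u ∈ A → old u ⟶⁺ copy A x
    copy→apex : ∀ {A B x} → TransitiveClique _⟶_ A → TransitiveClique _⟶_ B →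
                x ∈ B → copy A x ⟶⁺ apex A B
    apex→old  : ∀ {A B u} → TransitiveClique _⟶_ A → TransitiveClique _⟶_ B →
                u ∈ A → apex A B ⟶⁺ old u

  loopless⁺ : ∀ {u} → ¬ u ⟶⁺ u
  loopless⁺ (old→old e) = loopless e
  loopless⁺ (copy→copy e) = loopless e

  asym⁺ : ∀ {u v} → u ⟶⁺ v → ¬ v ⟶⁺ u
  asym⁺ (old→old e) (old→old e′) = asym e e′
  asym⁺ (copy→copy e) (copy→copy e′) = asym e e′

  -- If a triangle within one layer is dominated from the next layer, it lies in the attached clique
  -- `A` or `B`, which is transitive.
  noDominatedTriangle⁺ : NoDominatedTriangle _⟶⁺_
  noDominatedTriangle⁺ (old→old xy) (old→old yz) (old→old zx) (old→old xw) (old→old yw) (old→old zw) =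
    noDominatedTriangle xy yz zx xw yw zw
  noDominatedTriangle⁺ (old→old xy) (old→old yz) (old→old zx) (old→copy K x∈A) (old→copy _ y∈A) (old→copy _ z∈A) =
    clique-triangle-free _⟶_ loopless asym K x∈A y∈A z∈A xy yz zx
  noDominatedTriangle⁺ (copy→copy xy) (copy→copy yz) (copy→copy zx) (copy→copy xw) (copy→copy yw) (copy→copy zw) =
    noDominatedTriangle xy yz zx xw yw zw
  noDominatedTriangle⁺ (copy→copy xy) (copy→copy yz) (copy→copy zx) (copy→apex _ K x∈B) (copy→apex _ _ y∈B) (copy→apex _ _ z∈B) =
    clique-triangle-free _⟶_ loopless asym K x∈B y∈B z∈B xy yz zx

  -- A triangle through all three layers has no common out-neighbour: an apex points only to old
  -- vertices, a copy vertex never does.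
  noDominatedTriangle⁺ (old→copy _ _) (copy→apex _ _ _) (apex→old _ _ _) _ () (apex→old _ _ _)
  noDominatedTriangle⁺ (copy→apex _ _ _) (apex→old _ _ _) (old→copy _ _) () (apex→old _ _ _) _
  noDominatedTriangle⁺ (apex→old _ _ _) (old→copy _ _) (copy→apex _ _ _) (apex→old _ _ _) _ ()

  -- The layers are stacked in blocks of height `bound`. Distinct copies share a block and all
  -- apices tie, which is harmless as no arcs join them.
  rank⁺ : V⁺ → ℕ
  rank⁺ (old v) = rank v
  rank⁺ (copy _ v) = bound + rank v
  rank⁺ (apex _ _) = bound + bound

  rank⁺<bound⁺ : ∀ v → rank⁺ v < suc (bound + bound)
  rank⁺<bound⁺ (old v) = s≤s (≤-trans (<⇒≤ (rank<bound v)) (m≤m+n bound bound))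
  rank⁺<bound⁺ (copy _ v) = s≤s (+-monoʳ-≤ bound (<⇒≤ (rank<bound v)))
  rank⁺<bound⁺ (apex _ _) = n<1+n _

  copy≰old : ∀ {x v} → ¬ (bound + x ≤ rank v)
  copy≰old {x} {v} = <⇒≱ (<-≤-trans (rank<bound v) (m≤m+n bound x))

  apex≰copy : ∀ {v} → ¬ (bound + bound ≤ bound + rank v)
  apex≰copy {v} = <⇒≱ (+-monoʳ-< bound (rank<bound v))

  -- A normal form for neighbours of no larger rank: it forgets the direction of arcs between layers
  -- and leaves only downward attachments, so impossible pairs vanish from the case analysis.
  data LowerNeighbour : V⁺ → V⁺ → Set where
    old-old   : ∀ {u v} → SymClosure _⟶_ u v → rank u ≤ rank v → LowerNeighbour (old u) (old v)
    old-copy  : ∀ {A u x} → TransitiveClique _⟶_ A → u ∈ A → LowerNeighbour (old u) (copy A x)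
    copy-copy : ∀ {A x y} → SymClosure _⟶_ x y → rank x ≤ rank y → LowerNeighbour (copy A x) (copy A y)
    old-apex  : ∀ {A B u} → TransitiveClique _⟶_ A → u ∈ A → LowerNeighbour (old u) (apex A B)
    copy-apex : ∀ {A B x} → TransitiveClique _⟶_ A → TransitiveClique _⟶_ B → x ∈ B →
                LowerNeighbour (copy A x) (apex A B)

  lowerNeighbour : ∀ {u v} → SymClosure _⟶⁺_ u v → rank⁺ u ≤ rank⁺ v → LowerNeighbour u v
  lowerNeighbour (inj₁ (old→old e)) le = old-old (inj₁ e) le
  lowerNeighbour (inj₂ (old→old e)) le = old-old (inj₂ e) le
  lowerNeighbour (inj₁ (copy→copy e)) le = copy-copy (inj₁ e) (+-cancelˡ-≤ bound _ _ le)
  lowerNeighbour (inj₂ (copy→copy e)) le = copy-copy (inj₂ e) (+-cancelˡ-≤ bound _ _ le)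
  lowerNeighbour (inj₁ (old→copy K u∈A)) le = old-copy K u∈A
  lowerNeighbour (inj₂ (old→copy K u∈A)) le = contradiction le copy≰old
  lowerNeighbour (inj₁ (copy→apex K L x∈B)) le = copy-apex K L x∈B
  lowerNeighbour (inj₂ (copy→apex K L x∈B)) le = contradiction le apex≰copy
  lowerNeighbour (inj₁ (apex→old K L u∈A)) le = contradiction le copy≰old
  lowerNeighbour (inj₂ (apex→old K L u∈A)) le = old-apex K u∈A

  old-sym : ∀ {u v} → SymClosure _⟶_ u v → SymClosure _⟶⁺_ (old u) (old v)
  old-sym = Sum.map old→old old→old

  copy-sym : ∀ {A u v} → SymClosure _⟶_ u v → SymClosure _⟶⁺_ (copy A u) (copy A v)
  copy-sym = Sum.map copy→copy copy→copy

  -- Below a copy vertex lie the clique `A` and vertices of the same copy; below an apex lie the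
  -- cliques `A` and `B`. In both cases `A` is joined to the whole copy.
  lowerNeighbours-adjacent : ∀ {u v w} → LowerNeighbour u v → LowerNeighbour w v → u ≢ w →
    SymClosure _⟶⁺_ u w
  lowerNeighbours-adjacent (old-old uv u≤v) (old-old wv w≤v) u≢w =
    old-sym (simplicial uv wv (u≢w ∘ cong old) u≤v w≤v)
  lowerNeighbours-adjacent (old-copy K u∈A) (old-copy _ w∈A) u≢w =
    old-sym (clique-connected _⟶_ K u∈A w∈A (u≢w ∘ cong old))
  lowerNeighbours-adjacent (old-copy K u∈A) (copy-copy _ _) u≢w = inj₁ (old→copy K u∈A)
  lowerNeighbours-adjacent (copy-copy _ _) (old-copy K w∈A) u≢w = inj₂ (old→copy K w∈A)
  lowerNeighbours-adjacent (copy-copy uv u≤v) (copy-copy wv w≤v) u≢w =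
    copy-sym (simplicial uv wv (u≢w ∘ cong (copy _)) u≤v w≤v)
  lowerNeighbours-adjacent (old-apex K u∈A) (old-apex _ w∈A) u≢w =
    old-sym (clique-connected _⟶_ K u∈A w∈A (u≢w ∘ cong old))
  lowerNeighbours-adjacent (old-apex K u∈A) (copy-apex _ _ _) u≢w = inj₁ (old→copy K u∈A)
  lowerNeighbours-adjacent (copy-apex _ _ _) (old-apex K w∈A) u≢w = inj₂ (old→copy K w∈A)
  lowerNeighbours-adjacent (copy-apex _ L u∈B) (copy-apex _ _ w∈B) u≢w =
    copy-sym (clique-connected _⟶_ L u∈B w∈B (u≢w ∘ cong (copy _)))

  V⁺↔⊎ : V⁺ ↔ (V ⊎ (Clique × V) ⊎ (Clique × Clique))
  V⁺↔⊎ = mk↔ₛ′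
    (λ { (old v) → inj₁ v ; (copy A v) → inj₂ (inj₁ (A , v)) ; (apex A B) → inj₂ (inj₂ (A , B)) })
    (λ { (inj₁ v) → old v ; (inj₂ (inj₁ (A , v))) → copy A v ; (inj₂ (inj₂ (A , B))) → apex A B })
    (λ { (inj₁ _) → refl ; (inj₂ (inj₁ _)) → refl ; (inj₂ (inj₂ _)) → refl })
    (λ { (old _) → refl ; (copy _ _) → refl ; (apex _ _) → refl })

  enumeration⁺ : V⁺ ↔ Fin (size + (size ^ j * size + size ^ j * size ^ j))
  enumeration⁺ = ↔-trans V⁺↔⊎ (↔-trans
    (enumeration ⊎-cong ↔-trans
      (↔-trans (cliques ×-cong enumeration) (↔-sym *↔×) ⊎-cong
       ↔-trans (cliques ×-cong cliques) (↔-sym *↔×))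
      (↔-sym +↔⊎))
    (↔-sym +↔⊎))
    where
    cliques : Clique ↔ Fin (size ^ j)
    cliques = Vec↔Fin enumeration j

  extension : ChordalDigraph
  extension = record
    { digraph             = record
      { enumeration = enumeration⁺
      ; _⟶_         = _⟶⁺_
      ; loopless    = loopless⁺
      ; asym        = asym⁺
      }
    ; noDominatedTriangle = noDominatedTriangle⁺
    ; rank                = rank⁺
    ; rank<bound          = rank⁺<bound⁺
    ; simplicial          = λ uv wv u≢w u≤v w≤v →
        lowerNeighbours-adjacent (lowerNeighbour uv u≤v) (lowerNeighbour wv w≤v) u≢w
    }

  extension-forces : {k : ℕ} → ForcesRainbow k j G → ForcesRainbow k (suc j) extension
  extension-forces forces col noMono
    with forces (col ∘ old) (λ xy yz zx → noMono (old→old xy) (old→old yz) (old→old zx))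
  ... | A , A-clique , A-rainbow
    with forces (col ∘ copy A) (λ xy yz zx → noMono (copy→copy xy) (copy→copy yz) (copy→copy zx))
  ... | B , B-clique , B-rainbow
    with All.decide (inColours (col ∘ old) A ∘ col ∘ copy A) B
  ... | inj₂ someNew with fromAny someNew
  ... | b , _ , b-new =
    -- `A` dominates its whole copy, so `b` becomes the new sink.
    copy A b ∷ map old A
    , All.map⁺ (all-∈ A (old→copy A-clique)) ∷ AllPairs.map⁺ (AllPairs.map old→old A-clique)
    , subst (All (col (copy A b) ≢_)) (map-∘ col old A) b-new ∷ subst Unique (map-∘ col old A) A-rainbow
  extension-forces forces col noMono
      | A , A-clique , A-rainbow | B , B-clique , B-rainbow | inj₁ B⊆A =
    -- `B` dominates the apex, which becomes the new sink.
    apex A B ∷ map (copy A) B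
    , All.map⁺ (all-∈ B (copy→apex A-clique B-clique)) ∷ AllPairs.map⁺ (AllPairs.map copy→copy B-clique)
    , All.map⁺ (All.map⁺ (all-∈ B apex-new)) ∷ subst Unique (map-∘ col (copy A) B) B-rainbow
    where
    apex-new : ∀ {b} → b ∈ B → col (apex A B) ≢ col (copy A b)
    apex-new b∈B c≡b with All.lookup B⊆A b∈B
    ... | a , a∈A , b≡a = noMono (old→copy A-clique a∈A) (copy→apex A-clique B-clique b∈B)
      (apex→old A-clique B-clique a∈A) (sym b≡a) (sym c≡b)

-- The tower and the pigeonhole contradiction.

empty : ChordalDigraph
empty = record
  { digraph             = record
    { enumeration = ↔-sym 0↔⊥
    ; _⟶_         = λ ()
    ; loopless    = λ {}
    ; asym        = λ {}
    }
  ; noDominatedTriangle = λ {}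
  ; rank                = λ ()
  ; bound               = 0
  ; rank<bound          = λ ()
  ; simplicial          = λ {}
  }

tower : ℕ → ChordalDigraph
tower zero = empty
tower (suc j) = Extension.extension j (tower j)

-- The number of colours stays fixed while the clique size grows past it; the empty vector is the
-- rainbow clique at the start.
tower-forces : (k j : ℕ) → ForcesRainbow k j (tower j)
tower-forces k zero col _ = [] , [] , []
tower-forces k (suc j) = Extension.extension-forces j (tower j) (tower-forces k j)

unique-length : {k j : ℕ} {xs : Vec (Fin k) j} → Unique xs → ¬ k < j
unique-length {xs = xs} unique k<j with pigeonhole k<j (lookup xs)
... | i , j , i<j , eq = <⇒≢ i<j (lookup-injective unique i j eq)

theorem2p10 : (k : ℕ) → Σ Digraph λ D →
    IsChordalOrientation D × ¬ InducedCopy C3⇒K1 D × DichromaticGreaterThan D k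
theorem2p10 k =
  toDigraph digraph
  , simplicialRank⇒chordal digraph rank simplicial
  , noDominatedTriangle⇒C3⇒K1-free digraph noDominatedTriangle
  , λ dicolouring →
      let col , noMono = dicolouring⇒noMonochromaticTriangle digraph dicolouring
          -- Level `suc k` is the first at which the clique has more vertices than there are
          -- colours.
          _ , _ , rainbow = tower-forces k (suc k) col noMono
      in unique-length rainbow (n<1+n k)
  where open ChordalDigraph (tower (suc k))
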